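{- For every positive integer $n>1$ there is a prime number $p$ with $5n<p<6n$. -}

module Defs where

{-
By Legendre's formula n! is the product of p ^ ⌊n / p ^ k⌋ over all prime powers p ^ k.  Hence for

  F(t) = (180t)! (75t)! (50t)! (18t)! (12t)! t! / ((150t)! (90t)! (60t)! (36t)!)

the exponent of the prime p is the sum over k of C(⌊900t / p ^ k⌋), where C has period 900 (because
180 + 75 + 50 + 18 + 12 + 1 = 150 + 90 + 60 + 36), satisfies C ≤ 1, and on one period is positive only
at 5.  The value 5 is taken exactly at the prime powers in (150t , 180t], so F(t) is at most the
contribution of those times exp ψ(t) ≤ 4 ^ t, where ψ is Chebyshev's function.  By Stirling's formula
F(t) grows like 115 ^ t.  With t = ⌊n / 30⌋ the interval (150t , 180t] agrees with (5n , 6n) up to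
fewer than 150 integers; without a prime in (5n , 6n) only those integers and the primes up to √(180t)
contribute, and their factor is subexponential, which is impossible for n ≥ 693600.  Smaller n are
served by a list of 68 primes.
-}
module Submission where

open import Defs
open import Data.Bool using (Bool; true; T; _∧_; _∨_; not; if_then_else_)
open import Data.Bool.Properties using (T-∧; T-∨)
open import Data.Empty using (⊥; ⊥-elim)
open import Data.List using (List; []; _∷_; map)
open import Data.List.Relation.Binary.Pointwise using (Pointwise; []; _∷_)
open import Data.List.Relation.Unary.All using (All; []; _∷_)
open import Data.Nat
open import Data.Nat.DivMod
open import Data.Nat.Divisibility
open import Data.Nat.Induction using (<-rec)
open import Data.Nat.ListAction using (sum; product)
open import Data.Nat.Primality
open import Data.Nat.Primality.Factorisation using (factorise)
open import Data.Nat.Properties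
open import Data.Nat.Tactic.RingSolver using (solve-∀)
open import Data.Product using (_×_; _,_; proj₁; proj₂; ∃-syntax)
open import Data.Sum using (_⊎_; inj₁; inj₂)
open import Function.Bundles using (Equivalence)
open import Relation.Binary.PropositionalEquality
open import Relation.Nullary using (Dec; yes; no; does; ¬_; _×-dec_; contradiction)
open import Relation.Nullary.Decidable using (dec-true; dec-false; toWitness)
open import Algebra.Properties.CommutativeSemigroup +-commutativeSemigroup
  using () renaming (interchange to +-interchange)
open import Algebra.Properties.CommutativeSemigroup *-commutativeSemigroup
  using (x∙yz≈y∙xz) renaming (interchange to *-interchange)

-- Indicators, finite sums and finite products

ι : {P : Set} → Dec P → ℕ
ι P? = if does P? then 1 else 0

ι-yes : {P : Set} (P? : Dec P) → P → ι P? ≡ 1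
ι-yes P? p = cong (if_then 1 else 0) (dec-true P? p)

ι-no : {P : Set} (P? : Dec P) → ¬ P → ι P? ≡ 0
ι-no P? ¬p = cong (if_then 1 else 0) (dec-false P? ¬p)

ι≤1 : {P : Set} (P? : Dec P) → ι P? ≤ 1
ι≤1 (yes _) = ≤-refl
ι≤1 (no _) = z≤n

ι-mono : {P Q : Set} (P? : Dec P) (Q? : Dec Q) → (P → Q) → ι P? ≤ ι Q?
ι-mono (no _) Q? P⇒Q = z≤n
ι-mono (yes p) Q? P⇒Q = ≤-reflexive (sym (ι-yes Q? (P⇒Q p)))

ι-cong : {P Q : Set} (P? : Dec P) (Q? : Dec Q) → (P → Q) → (Q → P) → ι P? ≡ ι Q?
ι-cong P? Q? P⇒Q Q⇒P = ≤-antisym (ι-mono P? Q? P⇒Q) (ι-mono Q? P? Q⇒P)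

-- Sums and products over 1 ≤ i ≤ n.
∑ ∏ : ℕ → (ℕ → ℕ) → ℕ
∑ zero f = 0
∑ (suc n) f = ∑ n f + f (suc n)
∏ zero f = 1
∏ (suc n) f = ∏ n f * f (suc n)

module _ {f g : ℕ → ℕ} where

  ∑-mono : ∀ n → (∀ i → f (suc i) ≤ g (suc i)) → ∑ n f ≤ ∑ n g
  ∑-mono zero f≤g = z≤n
  ∑-mono (suc n) f≤g = +-mono-≤ (∑-mono n f≤g) (f≤g n)

  ∑-cong : ∀ n → (∀ i → f (suc i) ≡ g (suc i)) → ∑ n f ≡ ∑ n g
  ∑-cong zero f≡g = refl
  ∑-cong (suc n) f≡g = cong₂ _+_ (∑-cong n f≡g) (f≡g n)

  ∏-mono : ∀ n → (∀ i → f (suc i) ≤ g (suc i)) → ∏ n f ≤ ∏ n g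
  ∏-mono zero f≤g = ≤-refl
  ∏-mono (suc n) f≤g = *-mono-≤ (∏-mono n f≤g) (f≤g n)

  ∏-cong : ∀ n → (∀ i → f (suc i) ≡ g (suc i)) → ∏ n f ≡ ∏ n g
  ∏-cong zero f≡g = refl
  ∏-cong (suc n) f≡g = cong₂ _*_ (∏-cong n f≡g) (f≡g n)

∑-+ : ∀ n f g → ∑ n (λ i → f i + g i) ≡ ∑ n f + ∑ n g
∑-+ zero f g = refl
∑-+ (suc n) f g = trans (cong (_+ (f (suc n) + g (suc n))) (∑-+ n f g))
  (+-interchange (∑ n f) (∑ n g) (f (suc n)) (g (suc n)))

∏-* : ∀ n f g → ∏ n (λ i → f i * g i) ≡ ∏ n f * ∏ n g
∏-* zero f g = refl
∏-* (suc n) f g = trans (cong (_* (f (suc n) * g (suc n))) (∏-* n f g))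
  (*-interchange (∏ n f) (∏ n g) (f (suc n)) (g (suc n)))

∑-zero : ∀ n f → (∀ i → f (suc i) ≡ 0) → ∑ n f ≡ 0
∑-zero zero f f≡0 = refl
∑-zero (suc n) f f≡0 = cong₂ _+_ (∑-zero n f f≡0) (f≡0 n)

∏-one : ∀ n f → (∀ i → f (suc i) ≡ 1) → ∏ n f ≡ 1
∏-one zero f f≡1 = refl
∏-one (suc n) f f≡1 = cong₂ _*_ (∏-one n f f≡1) (f≡1 n)

∏-^ : ∀ n b f → ∏ n (λ i → b ^ f i) ≡ b ^ ∑ n f
∏-^ zero b f = refl
∏-^ (suc n) b f = trans (cong (_* b ^ f (suc n)) (∏-^ n b f))
  (sym (^-distribˡ-+-* b (∑ n f) (f (suc n))))

-- Re-indexing without subtraction, for the step where cancelling a prime turns `r ^ k` into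
-- `r ^ pred k`.
∑-shift : ∀ n f → ∑ n (λ i → f (pred i)) + f n ≡ f 0 + ∑ n f
∑-shift zero f = sym (+-identityʳ (f 0))
∑-shift (suc n) f = trans (cong (_+ f (suc n)) (∑-shift n f)) (+-assoc (f 0) (∑ n f) (f (suc n)))

∏-cong-≤ : ∀ {f g} n → (∀ i → 0 < i → i ≤ n → f i ≡ g i) → ∏ n f ≡ ∏ n g
∏-cong-≤ zero f≡g = refl
∏-cong-≤ (suc n) f≡g = cong₂ _*_ (∏-cong-≤ n λ i 0<i i≤n → f≡g i 0<i (m≤n⇒m≤1+n i≤n)) (f≡g (suc n) z<s ≤-refl)

-- Serves the induction on prime factors, where a new prime `r` alters only the factor at `r`.
∏-update : ∀ {f g} n c r → 0 < r → r ≤ n → (∀ i → i ≢ r → f i ≡ g i) → f r ≡ c * g r →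
  ∏ n f ≡ c * ∏ n g
∏-update zero c r 0<r r≤0 f≡g fr = contradiction (≤-trans 0<r r≤0) λ ()
∏-update {f} {g} (suc n) c r 0<r r≤n f≡g fr with r ≟ suc n
... | yes refl = trans
  (cong₂ _*_ (∏-cong-≤ n λ i _ i≤n → f≡g i (<⇒≢ (s≤s i≤n))) fr)
  (x∙yz≈y∙xz (∏ n g) c (g (suc n)))
... | no r≢ = trans
  (cong₂ _*_ (∏-update n c r 0<r (≤-pred (≤∧≢⇒< r≤n r≢)) f≡g fr) (f≡g (suc n) (≢-sym r≢)))
  (*-assoc c (∏ n g) (g (suc n)))

∑-interval : ∀ n a b → ∑ n (λ i → ι (a <? i ×-dec i ≤? b)) ≤ b ∸ a
∑-interval n a b = ≤-trans (strong n) (∸-monoˡ-≤ a (m⊓n≤n n b))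
  where
  -- Capping at `n ⊓ b` lets the induction close: the bound gains one at each `i` in the interval.
  strong : ∀ n → ∑ n (λ i → ι (a <? i ×-dec i ≤? b)) ≤ (n ⊓ b) ∸ a
  strong zero = z≤n
  strong (suc n) with a <? suc n ×-dec suc n ≤? b
  ... | yes a<n≤b@(a<n , n≤b) = begin
    ∑ (suc n) _        ≡⟨ cong (∑ n _ +_) (ι-yes (a <? suc n ×-dec suc n ≤? b) a<n≤b) ⟩
    ∑ n _ + 1          ≤⟨ +-monoˡ-≤ 1 (strong n) ⟩
    (n ⊓ b) ∸ a + 1    ≡⟨ cong (λ z → z ∸ a + 1) (m≤n⇒m⊓n≡m (<⇒≤ n≤b)) ⟩
    n ∸ a + 1          ≡⟨ +-comm (n ∸ a) 1 ⟩
    1 + (n ∸ a)        ≡⟨ +-∸-assoc 1 (≤-pred a<n) ⟨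
    suc n ∸ a          ≡⟨ cong (_∸ a) (m≤n⇒m⊓n≡m n≤b) ⟨
    (suc n ⊓ b) ∸ a    ∎
    where open ≤-Reasoning
  ... | no a≮n≤b = begin
    ∑ (suc n) _        ≡⟨ cong (∑ n _ +_) (ι-no (a <? suc n ×-dec suc n ≤? b) a≮n≤b) ⟩
    ∑ n _ + 0          ≡⟨ +-identityʳ _ ⟩
    ∑ n _              ≤⟨ strong n ⟩
    (n ⊓ b) ∸ a        ≤⟨ ∸-monoˡ-≤ a (⊓-monoˡ-≤ b (n≤1+n n)) ⟩
    (suc n ⊓ b) ∸ a    ∎
    where open ≤-Reasoning

-- Legendre's formula

-- Nonprime bases get exponent 0, so `mangoldt` can multiply over all `p ≤ N`. Cutting `k` at `N`
-- loses nothing when `f` vanishes beyond `N`, because `p ^ k > k` for a prime `p`.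
exponent : ℕ → (ℕ → ℕ) → ℕ → ℕ
exponent N f p = ι (prime? p) * ∑ N (λ k → f (p ^ k))

-- exp (∑ Λ(q) f(q)), with Λ the von Mangoldt function and q running over the powers p ^ k
-- with p, k ≤ N.
mangoldt : ℕ → (ℕ → ℕ) → ℕ
mangoldt N f = ∏ N (λ p → p ^ exponent N f p)

-- The bridge from pointwise inequalities of floor functions to inequalities of factorials.
mangoldt-mono : ∀ N {f g} → (∀ q → .{{NonZero q}} → f q ≤ g q) → mangoldt N f ≤ mangoldt N g
mangoldt-mono N f≤g = ∏-mono N λ i → ^-monoʳ-≤ (suc i)
  (*-monoʳ-≤ (ι (prime? (suc i))) (∑-mono N λ k → f≤g (suc i ^ suc k) {{m^n≢0 (suc i) (suc k)}}))

mangoldt-cong : ∀ N {f g} → (∀ q → .{{NonZero q}} → f q ≡ g q) → mangoldt N f ≡ mangoldt N g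
mangoldt-cong N f≡g = ≤-antisym (mangoldt-mono N λ q → ≤-reflexive (f≡g q))
                                (mangoldt-mono N λ q → ≤-reflexive (sym (f≡g q)))

mangoldt-+ : ∀ N f g → mangoldt N (λ q → f q + g q) ≡ mangoldt N f * mangoldt N g
mangoldt-+ N f g = begin
  mangoldt N (λ q → f q + g q)
    ≡⟨ ∏-cong N (λ i → cong (suc i ^_) (exp-+ (suc i))) ⟩
  ∏ N (λ p → p ^ (exponent N f p + exponent N g p))
    ≡⟨ ∏-cong N (λ i → ^-distribˡ-+-* (suc i) (exponent N f (suc i)) (exponent N g (suc i))) ⟩
  ∏ N (λ p → p ^ exponent N f p * p ^ exponent N g p)
    ≡⟨ ∏-* N _ _ ⟩
  mangoldt N f * mangoldt N g ∎
  where
  open ≡-Reasoning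
  exp-+ : ∀ p → exponent N (λ q → f q + g q) p ≡ exponent N f p + exponent N g p
  exp-+ p = trans (cong (ι (prime? p) *_) (∑-+ N (λ k → f (p ^ k)) (λ k → g (p ^ k))))
    (*-distribˡ-+ (ι (prime? p)) (∑ N (λ k → f (p ^ k))) (∑ N (λ k → g (p ^ k))))

mangoldt-0 : ∀ N f → (∀ q → .{{NonZero q}} → f q ≡ 0) → mangoldt N f ≡ 1
mangoldt-0 N f f≡0 = ∏-one N _ λ i → cong (suc i ^_)
  (trans (cong (ι (prime? (suc i)) *_)
               (∑-zero N _ λ k → f≡0 (suc i ^ suc k) {{m^n≢0 (suc i) (suc k)}}))
         (*-zeroʳ (ι (prime? (suc i)))))

n<p^n : ∀ p n → 1 < p → n < p ^ n
n<p^n p zero 1<p = s≤s z≤n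
n<p^n p (suc n) 1<p = begin-strict
  suc n       ≤⟨ n<p^n p n 1<p ⟩
  p ^ n       <⟨ ^-monoʳ-< p 1<p (n<1+n n) ⟩
  p ^ suc n   ∎
  where open ≤-Reasoning

prime⇒>1 : ∀ {p} → Prime p → 1 < p
prime⇒>1 pp = nonTrivial⇒n>1 _ {{prime⇒nonTrivial pp}}

prime-∣-prime : ∀ {p r} → Prime p → Prime r → p ∣ r → p ≡ r
prime-∣-prime pp pr p∣r with prime⇒irreducible pr p∣r
... | inj₁ refl = contradiction pp ¬prime[1]
... | inj₂ p≡r = p≡r

-- Euclid's lemma finds one `p` in `m`; cancelling it from both sides lowers `k`.
prime-power-cancel : ∀ {p r} → Prime p → Prime r → p ≢ r → ∀ k m → p ^ k ∣ r * m → p ^ k ∣ m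
prime-power-cancel pp pr p≢r zero m _ = 1∣ m
prime-power-cancel {p} {r} pp pr p≢r (suc k) m pᵏ∣rm with euclidsLemma r m pp (m*n∣⇒m∣ p (p ^ k) pᵏ∣rm)
... | inj₁ p∣r = contradiction (prime-∣-prime pp pr p∣r) p≢r
... | inj₂ (divides-refl m′) = subst (p * p ^ k ∣_) (*-comm p m′) (*-monoʳ-∣ p
  (prime-power-cancel pp pr p≢r k m′ (*-cancelˡ-∣ p {{prime⇒nonZero pp}}
    (subst (p * p ^ k ∣_) (trans (cong (r *_) (*-comm m′ p)) (x∙yz≈y∙xz r p m′)) pᵏ∣rm))))

-- The identity log n = ∑ Λ(q) over q ∣ n, by induction on the prime factors: a further prime `r`
-- leaves the other exponents alone and raises its own by one.
mangoldt-∣-product : ∀ N {ps} → All Prime ps → product ps ≤ N →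
  mangoldt N (λ q → ι (q ∣? product ps)) ≡ product ps
mangoldt-∣-product N {[]} [] _ = ∏-one N _ λ i → cong (suc i ^_) (exp-1 i)
  where
  exp-1 : ∀ i → exponent N (λ q → ι (q ∣? 1)) (suc i) ≡ 0
  exp-1 i with prime? (suc i)
  ... | no _ = refl
  ... | yes pp = trans (*-identityˡ _) (∑-zero N _ λ k → ι-no (suc i ^ suc k ∣? 1)
      λ q∣1 → contradiction (n<p^n (suc i) (suc k) (prime⇒>1 pp)) (≤⇒≯ (≤-trans (∣⇒≤ q∣1) (s≤s z≤n))))
mangoldt-∣-product N {r ∷ ps} (pr ∷ pps) rm≤N = trans
  (∏-update N r r 0<r r≤N (λ p p≢r → cong (p ^_) (other p p≢r)) (cong (r ^_) same))
  (cong (r *_) (mangoldt-∣-product N pps m≤N))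
  where
  open ≡-Reasoning
  m = product ps
  instance
    _ = prime⇒nonZero pr
    _ = productOfPrimes≢0 pps
  0<r : 0 < r
  0<r = >-nonZero⁻¹ r
  m≤N : m ≤ N
  m≤N = ≤-trans (m≤n*m m r) rm≤N
  r≤N : r ≤ N
  r≤N = ≤-trans (m≤m*n r m) rm≤N

  other : ∀ p → p ≢ r → exponent N (λ q → ι (q ∣? r * m)) p ≡ exponent N (λ q → ι (q ∣? m)) p
  other p p≢r with prime? p
  ... | no _ = refl
  ... | yes pp = cong (1 *_) (∑-cong N λ k → ι-cong (p ^ suc k ∣? r * m) (p ^ suc k ∣? m)
      (prime-power-cancel pp pr p≢r (suc k) m) (∣n⇒∣m*n r))

  -- Cancelling `r` replaces `r ^ k ∣ r * m` by `r ^ pred k ∣ m`. Shifting back gains the term at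
  -- `r ^ 0`, which is 1, and drops the term at `r ^ N`, which is 0 since `r ^ N > m`.
  same : exponent N (λ q → ι (q ∣? r * m)) r ≡ suc (exponent N (λ q → ι (q ∣? m)) r)
  same = begin
    ι (prime? r) * ∑ N (λ k → ι (r ^ k ∣? r * m))
      ≡⟨ cong₂ _*_ (ι-yes (prime? r) pr) (∑-cong N λ k →
           ι-cong (r * r ^ k ∣? r * m) (r ^ k ∣? m) (*-cancelˡ-∣ r) (*-monoʳ-∣ r)) ⟩
    1 * ∑ N (λ k → ι (r ^ pred k ∣? m))
      ≡⟨ *-identityˡ _ ⟩
    ∑ N (λ k → ι (r ^ pred k ∣? m))
      ≡⟨ +-identityʳ _ ⟨
    ∑ N (λ k → ι (r ^ pred k ∣? m)) + 0
      ≡⟨ cong (∑ N (λ k → ι (r ^ pred k ∣? m)) +_) (ι-no (r ^ N ∣? m) λ rᴺ∣m →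
           contradiction (≤-<-trans m≤N (n<p^n r N (prime⇒>1 pr))) (≤⇒≯ (∣⇒≤ rᴺ∣m))) ⟨
    ∑ N (λ k → ι (r ^ pred k ∣? m)) + ι (r ^ N ∣? m)
      ≡⟨ ∑-shift N (λ k → ι (r ^ k ∣? m)) ⟩
    ι (1 ∣? m) + ∑ N (λ k → ι (r ^ k ∣? m))
      ≡⟨ cong₂ _+_ (ι-yes (1 ∣? m) (1∣ m)) (sym (*-identityˡ _)) ⟩
    suc (1 * ∑ N (λ k → ι (r ^ k ∣? m)))
      ≡⟨ cong (λ z → suc (z * ∑ N (λ k → ι (r ^ k ∣? m)))) (ι-yes (prime? r) pr) ⟨
    suc (exponent N (λ q → ι (q ∣? m)) r) ∎

mangoldt-∣ : ∀ N n → .{{NonZero n}} → n ≤ N → mangoldt N (λ q → ι (q ∣? n)) ≡ n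
mangoldt-∣ N n n≤N with factorise n
... | record { isFactorisation = refl ; factorsPrime = pps } = mangoldt-∣-product N pps n≤N

infixl 7 _÷_
-- Total, so that `n ÷_` can be passed to `mangoldt`, which evaluates it only at powers of positive
-- bases.
_÷_ : ℕ → ℕ → ℕ
n ÷ zero = 0
n ÷ q@(suc _) = n / q

-- For positive `q`, the remainder of `n` either wraps to 0, exactly when `q` divides `suc n`, or
-- grows by one with the quotient unchanged.
suc-÷ : ∀ n q → suc n ÷ q ≡ n ÷ q + ι (q ∣? suc n)
suc-÷ n zero = refl
suc-÷ n q@(suc q′) with suc (n % q) ≟ q
... | yes r≡q = begin
  suc n / q                ≡⟨ cong (_/ q) n≡ ⟩
  suc (n / q) * q / q      ≡⟨ m*n/n≡m (suc (n / q)) q ⟩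
  suc (n / q)              ≡⟨ +-comm 1 (n / q) ⟩
  n / q + 1                ≡⟨ cong (n / q +_) (ι-yes (q ∣? suc n) (divides (suc (n / q)) n≡)) ⟨
  n / q + ι (q ∣? suc n)   ∎
  where
  open ≡-Reasoning
  n≡ : suc n ≡ suc (n / q) * q
  n≡ = trans (cong suc (m≡m%n+[m/n]*n n q)) (cong (_+ n / q * q) r≡q)
... | no r≢q = begin
  suc n / q                ≡⟨ cong (_/ q) n≡ ⟩
  (r + n / q * q) / q      ≡⟨ +-distrib-/-∣ʳ r (n∣m*n (n / q)) ⟩
  r / q + n / q * q / q    ≡⟨ cong₂ _+_ (m<n⇒m/n≡0 r<q) (m*n/n≡m (n / q) q) ⟩
  n / q                    ≡⟨ +-identityʳ (n / q) ⟨
  n / q + 0                ≡⟨ cong (n / q +_) (ι-no (q ∣? suc n) λ q∣n →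
                                contradiction (∣⇒≤ (q∣r q∣n)) (<⇒≱ r<q)) ⟨
  n / q + ι (q ∣? suc n)   ∎
  where
  open ≡-Reasoning
  r = suc (n % q)
  r<q : r < q
  r<q = ≤∧≢⇒< (m%n<n n q) r≢q
  n≡ : suc n ≡ r + n / q * q
  n≡ = cong suc (m≡m%n+[m/n]*n n q)
  q∣r : q ∣ suc n → q ∣ r
  q∣r q∣n = ∣m+n∣m⇒∣n (subst (q ∣_) (trans n≡ (+-comm r _)) q∣n) (n∣m*n (n / q))

-- By `suc-÷`, passing from `n` to `suc n` adds the indicator of `q ∣ suc n`, which contributes the
-- factor `suc n`.
mangoldt-! : ∀ N n → n ≤ N → mangoldt N (n ÷_) ≡ n !
mangoldt-! N zero _ = mangoldt-0 N (0 ÷_) λ { (suc q) → 0/n≡0 (suc q) }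
mangoldt-! N (suc n) n<N = begin
  mangoldt N (suc n ÷_)                                 ≡⟨ mangoldt-cong N (λ q → suc-÷ n q) ⟩
  mangoldt N (λ q → n ÷ q + ι (q ∣? suc n))             ≡⟨ mangoldt-+ N (n ÷_) (λ q → ι (q ∣? suc n)) ⟩
  mangoldt N (n ÷_) * mangoldt N (λ q → ι (q ∣? suc n))
                                                        ≡⟨ cong₂ _*_ (mangoldt-! N n (<⇒≤ n<N))
                                                                       (mangoldt-∣ N (suc n) n<N) ⟩
  n ! * suc n                                           ≡⟨ *-comm (n !) (suc n) ⟩
  suc n * n !                                           ∎
  where open ≡-Reasoning

-- Chebyshev's bound ψ(n) ≤ n log 4

k*q≤m⇒k≤m/q : ∀ k q m .{{_ : NonZero q}} → k * q ≤ m → k ≤ m / q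
k*q≤m⇒k≤m/q k q m kq≤m = subst (_≤ m / q) (m*n/n≡m k q) (/-monoˡ-≤ q kq≤m)

÷-superadditive : ∀ a b q → a ÷ q + b ÷ q ≤ (a + b) ÷ q
÷-superadditive a b zero = z≤n
÷-superadditive a b q@(suc _) = k*q≤m⇒k≤m/q (a / q + b / q) q (a + b) (begin
  (a / q + b / q) * q     ≡⟨ *-distribʳ-+ q (a / q) (b / q) ⟩
  a / q * q + b / q * q   ≤⟨ +-mono-≤ (m/n*n≤m a q) (m/n*n≤m b q) ⟩
  a + b                   ∎)
  where open ≤-Reasoning

-- For `q > b` both floors on the left vanish, while the one on the right is positive once
-- `q ≤ a + b`. For `q ≤ b` superadditivity suffices.
÷-binomial : ∀ {a b} → a ≤ b → ∀ q → .{{NonZero q}} →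
  a ÷ q + b ÷ q + ι (q ≤? a + b) ≤ (a + b) ÷ q + ι (q ≤? b)
÷-binomial {a} {b} a≤b q@(suc _) with ≤-<-connex q b
... | inj₁ q≤b = +-mono-≤ (÷-superadditive a b q)
  (ι-mono (q ≤? a + b) (q ≤? b) (λ _ → q≤b))
... | inj₂ b<q = begin
  a / q + b / q + ι (q ≤? a + b)
    ≡⟨ cong₂ (λ x y → x + y + ι (q ≤? a + b)) (m<n⇒m/n≡0 (≤-<-trans a≤b b<q)) (m<n⇒m/n≡0 b<q) ⟩
  ι (q ≤? a + b)
    ≤⟨ ι≤quotient (q ≤? a + b) ⟩
  (a + b) / q
    ≤⟨ m≤m+n _ _ ⟩
  (a + b) / q + ι (q ≤? b) ∎
  where
  open ≤-Reasoning
  ι≤quotient : (q≤? : Dec (q ≤ a + b)) → ι q≤? ≤ (a + b) / q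
  ι≤quotient (no _) = z≤n
  ι≤quotient (yes q≤a+b) = m≥n⇒m/n>0 q≤a+b

-- exp (ψ(y)), with ψ Chebyshev's function.
Ψ : ℕ → ℕ → ℕ
Ψ N y = mangoldt N (λ q → ι (q ≤? y))

-- Without division: exp(ψ(a + b) - ψ(b)) is at most the binomial coefficient of `a + b` over `a`.
Ψ-binomial : ∀ N {a b} → a ≤ b → a + b ≤ N → a ! * b ! * Ψ N (a + b) ≤ (a + b) ! * Ψ N b
Ψ-binomial N {a} {b} a≤b a+b≤N = begin
  a ! * b ! * Ψ N (a + b)
    ≡⟨ cong (_* Ψ N (a + b)) (cong₂ _*_ (mangoldt-! N a (m+n≤o⇒m≤o a a+b≤N))
                                        (mangoldt-! N b (m+n≤o⇒n≤o a a+b≤N))) ⟨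
  mangoldt N (a ÷_) * mangoldt N (b ÷_) * Ψ N (a + b)
    ≡⟨ cong (_* Ψ N (a + b)) (mangoldt-+ N (a ÷_) (b ÷_)) ⟨
  mangoldt N (λ q → a ÷ q + b ÷ q) * Ψ N (a + b)
    ≡⟨ mangoldt-+ N (λ q → a ÷ q + b ÷ q) (λ q → ι (q ≤? a + b)) ⟨
  mangoldt N (λ q → a ÷ q + b ÷ q + ι (q ≤? a + b))
    ≤⟨ mangoldt-mono N (λ q → ÷-binomial a≤b q) ⟩
  mangoldt N (λ q → (a + b) ÷ q + ι (q ≤? b))
    ≡⟨ mangoldt-+ N ((a + b) ÷_) (λ q → ι (q ≤? b)) ⟩
  mangoldt N ((a + b) ÷_) * Ψ N b
    ≡⟨ cong (_* Ψ N b) (mangoldt-! N (a + b) a+b≤N) ⟩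
  (a + b) ! * Ψ N b ∎
  where open ≤-Reasoning

-- Consecutive middle binomial coefficients have ratio (2a + 3)(2a + 2) / ((a + 1)(a + 2)) < 4.
[2a+1]!≤4^a*a!*[a+1]! : ∀ a → (a + suc a) ! ≤ 4 ^ a * (a ! * (suc a) !)
[2a+1]!≤4^a*a!*[a+1]! zero = ≤-refl
[2a+1]!≤4^a*a!*[a+1]! (suc a) = begin
  (suc a + suc (suc a)) !
    ≡⟨ cong (λ z → (suc z) !) (+-suc a (suc a)) ⟩
  suc (suc (a + suc a)) * (suc (a + suc a) * (a + suc a) !)
    ≤⟨ *-monoʳ-≤ (suc (suc (a + suc a))) (*-monoʳ-≤ (suc (a + suc a)) ([2a+1]!≤4^a*a!*[a+1]! a)) ⟩
  suc (suc (a + suc a)) * (suc (a + suc a) * (4 ^ a * (a ! * (suc a) !)))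
    ≤⟨ m≤m+n _ _ ⟩
  suc (suc (a + suc a)) * (suc (a + suc a) * (4 ^ a * (a ! * (suc a) !)))
    + suc (a + suc a) * (4 ^ a * (a ! * (suc a) !))
    ≡⟨ arith a (4 ^ a) (a !) ((suc a) !) ⟩
  4 * 4 ^ a * (suc a * a ! * (suc (suc a) * (suc a) !)) ∎
  where
  open ≤-Reasoning
  arith : ∀ a x y z →
    suc (suc (a + suc a)) * (suc (a + suc a) * (x * (y * z))) + suc (a + suc a) * (x * (y * z))
    ≡ 4 * x * (suc a * y * (suc (suc a) * z))
  arith = solve-∀

[2a]!≤4^a*a!² : ∀ a → (a + a) ! ≤ 4 ^ a * (a ! * a !)
[2a]!≤4^a*a!² zero = ≤-refl
[2a]!≤4^a*a!² (suc a) = begin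
  suc (a + suc a) * (a + suc a) !
    ≤⟨ *-monoʳ-≤ (suc (a + suc a)) ([2a+1]!≤4^a*a!*[a+1]! a) ⟩
  suc (a + suc a) * (4 ^ a * (a ! * (suc a) !))
    ≤⟨ m≤n*m _ 2 ⟩
  2 * (suc (a + suc a) * (4 ^ a * (a ! * (suc a) !)))
    ≡⟨ arith a (4 ^ a) (a !) ((suc a) !) ⟩
  4 * 4 ^ a * (suc a * a ! * (suc a) !) ∎
  where
  open ≤-Reasoning
  arith : ∀ a x y z → 2 * (suc (a + suc a) * (x * (y * z))) ≡ 4 * x * (suc a * y * z)
  arith = solve-∀

Ψ-step : ∀ N {a b} → a ≤ b → a + b ≤ N → (a + b) ! ≤ 4 ^ a * (a ! * b !) → Ψ N b ≤ 4 ^ b →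
  Ψ N (a + b) ≤ 4 ^ (a + b)
Ψ-step N {a} {b} a≤b a+b≤N binom≤ ih =
  *-cancelˡ-≤ (a ! * b !) {{m*n≢0 (a !) (b !) {{a !≢0}} {{b !≢0}}}} (begin
    a ! * b ! * Ψ N (a + b)               ≤⟨ Ψ-binomial N a≤b a+b≤N ⟩
    (a + b) ! * Ψ N b                     ≤⟨ *-mono-≤ binom≤ ih ⟩
    4 ^ a * (a ! * b !) * 4 ^ b           ≡⟨ arith (4 ^ a) (a ! * b !) (4 ^ b) ⟩
    a ! * b ! * (4 ^ a * 4 ^ b)           ≡⟨ cong (a ! * b ! *_) (^-distribˡ-+-* 4 a b) ⟨
    a ! * b ! * 4 ^ (a + b)               ∎)
  where
  open ≤-Reasoning
  arith : ∀ x y z → x * y * z ≡ y * (x * z)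
  arith = solve-∀

half : ∀ n → ∃[ a ] (n ≡ a + a ⊎ n ≡ a + suc a)
half zero = 0 , inj₁ refl
half (suc n) with half n
... | a , inj₁ refl = a , inj₂ (sym (+-suc a a))
... | a , inj₂ refl = suc a , inj₁ refl

-- Strong induction by halving: `n = a + b` with `b` the larger half, where the binomial coefficient
-- costs `4 ^ a` and the induction hypothesis `4 ^ b`.
Ψ≤4^ : ∀ N n → n ≤ N → Ψ N n ≤ 4 ^ n
Ψ≤4^ N = <-rec (λ n → n ≤ N → Ψ N n ≤ 4 ^ n) go
  where
  go : ∀ n → (∀ {m} → m < n → m ≤ N → Ψ N m ≤ 4 ^ m) → n ≤ N → Ψ N n ≤ 4 ^ n
  go n ih n≤N with half n
  ... | zero , inj₁ refl = ≤-reflexive (mangoldt-0 N _ λ q → ι-no (q ≤? 0) (<⇒≱ (>-nonZero⁻¹ q)))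
  ... | suc a , inj₁ refl = Ψ-step N ≤-refl n≤N ([2a]!≤4^a*a!² (suc a))
    (ih (m<m+n (suc a) z<s) (m+n≤o⇒m≤o (suc a) n≤N))
  ... | zero , inj₂ refl = ≤-trans
    (mangoldt-mono N λ q → ι-mono (q ≤? 1) (q ∣? 1) λ q≤1 → ∣-reflexive (≤-antisym q≤1 (>-nonZero⁻¹ q)))
    (≤-trans (≤-reflexive (mangoldt-∣ N 1 n≤N)) (m≤m+n 1 3))
  ... | suc a , inj₂ refl = Ψ-step N (n≤1+n (suc a)) n≤N ([2a+1]!≤4^a*a!*[a+1]! (suc a))
    (ih (m<n+m (suc (suc a)) z<s) (m+n≤o⇒n≤o (suc a) n≤N))

-- Prime powers in a short interval

∑-ι≤ : ∀ n {P : ℕ → Set} (P? : ∀ i → Dec (P i)) → ∑ n (λ i → ι (P? i)) ≤ n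
∑-ι≤ zero P? = z≤n
∑-ι≤ (suc n) P? = ≤-trans (+-mono-≤ (∑-ι≤ n P?) (ι≤1 (P? (suc n)))) (≤-reflexive (+-comm n 1))

-- `K` is lowered until `p ^ K ≤ b`; then at most `K` powers are counted.
∏-powers≤ : ∀ p a b K .{{_ : NonZero p}} .{{_ : NonZero b}} →
  p ^ ∑ K (λ k → ι (a <? p ^ k ×-dec p ^ k ≤? b)) ≤ b
∏-powers≤ p a b zero = >-nonZero⁻¹ b
∏-powers≤ p a b (suc K) with p ^ suc K ≤? b
... | yes pᴷ≤b = ≤-trans (^-monoʳ-≤ p (∑-ι≤ (suc K) (λ k → a <? p ^ k ×-dec p ^ k ≤? b))) pᴷ≤b
... | no pᴷ≰b = ≤-trans (≤-reflexive (cong (p ^_) (trans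
  (cong (∑ K (λ k → ι (a <? p ^ k ×-dec p ^ k ≤? b)) +_)
        (ι-no (a <? p ^ suc K ×-dec p ^ suc K ≤? b) λ (_ , pᴷ≤b) → pᴷ≰b pᴷ≤b))
  (+-identityʳ _)))) (∏-powers≤ p a b K)

-- Only primes up to √b, and primes in (a , a + c], have a power in (a , b].
mangoldt-gap : ∀ N a b c s .{{_ : NonZero b}} → b < s * s →
  (∀ {p} → Prime p → a + c < p → p ≤ b → ⊥) →
  mangoldt N (λ q → ι (a <? q ×-dec q ≤? b)) ≤ b ^ (s + c)
mangoldt-gap N a b c s b<s² none = begin
  mangoldt N f                        ≤⟨ ∏-mono N (λ i → local (suc i)) ⟩
  ∏ N (λ p → b ^ h p)                 ≡⟨ ∏-^ N b h ⟩
  b ^ ∑ N h                           ≤⟨ ^-monoʳ-≤ b h≤ ⟩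
  b ^ (s + c)                         ∎
  where
  open ≤-Reasoning
  f h : ℕ → ℕ
  f q = ι (a <? q ×-dec q ≤? b)
  -- `h` marks the bases that may contribute. Each contributes at most `b`, so counting them bounds
  -- the exponent of `b`.
  h p = ι (0 <? p ×-dec p ≤? s) + ι (a <? p ×-dec p ≤? a + c)
  h≤ : ∑ N h ≤ s + c
  h≤ = begin
    ∑ N h                ≡⟨ ∑-+ N (λ p → ι (0 <? p ×-dec p ≤? s)) (λ p → ι (a <? p ×-dec p ≤? a + c)) ⟩
    ∑ N (λ p → ι (0 <? p ×-dec p ≤? s)) + ∑ N (λ p → ι (a <? p ×-dec p ≤? a + c))
                         ≤⟨ +-mono-≤ (∑-interval N 0 s) (∑-interval N a (a + c)) ⟩
    s + (a + c ∸ a)      ≡⟨ cong (s +_) (m+n∸m≡n a c) ⟩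
    s + c                ∎
  counted : ∀ {p} → .{{NonZero p}} → 1 ≤ h p → p ^ (1 * ∑ N (λ k → f (p ^ k))) ≤ b ^ h p
  counted {p} 1≤h = begin
    p ^ (1 * ∑ N (λ k → f (p ^ k)))   ≡⟨ cong (p ^_) (*-identityˡ (∑ N (λ k → f (p ^ k)))) ⟩
    p ^ ∑ N (λ k → f (p ^ k))         ≤⟨ ∏-powers≤ p a b N ⟩
    b                                 ≡⟨ *-identityʳ b ⟨
    b ^ 1                             ≤⟨ ^-monoʳ-≤ b 1≤h ⟩
    b ^ h p                           ∎
  local : ∀ p → .{{NonZero p}} → p ^ exponent N f p ≤ b ^ h p
  local p with prime? p
  ... | no _ = m^n>0 b (h p)
  ... | yes pp with 0 <? p ×-dec p ≤? s | a <? p ×-dec p ≤? a + c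
  ...   | yes p≤s | _ = counted
    (≤-trans (≤-reflexive (sym (ι-yes (0 <? p ×-dec p ≤? s) p≤s))) (m≤m+n _ _))
  ...   | no _ | yes p∈ = counted
    (≤-trans (≤-reflexive (sym (ι-yes (a <? p ×-dec p ≤? a + c) p∈))) (m≤n+m _ (ι (0 <? p ×-dec p ≤? s))))
  ...   | no p≰s | no p∉ = ≤-trans
    (≤-reflexive (cong (p ^_) (trans (*-identityˡ (∑ N (λ k → f (p ^ k)))) (∑-zero N _ f≡0))))
    (m^n>0 b (h p))
    where
    s<p : s < p
    s<p = ≰⇒> λ p≤s → p≰s (>-nonZero⁻¹ p , p≤s)
    -- A first power in the interval is a prime excluded by `none`; a higher power of `p > s` is at
    -- least `s * s > b`.
    outside : ∀ k → ¬ (a < p ^ suc k × p ^ suc k ≤ b)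
    outside zero (a<p¹ , p¹≤b) = none pp (≰⇒> λ p≤a+c → p∉ (a<p , p≤a+c)) p≤b
      where
      a<p = subst (a <_) (*-identityʳ p) a<p¹
      p≤b = subst (_≤ b) (*-identityʳ p) p¹≤b
    outside (suc k) (_ , pᵏ≤b) = <⇒≱ b<s² (begin
      s * s             ≤⟨ *-mono-≤ (<⇒≤ s<p) (<⇒≤ s<p) ⟩
      p * p             ≤⟨ *-monoʳ-≤ p (m≤m*n p (p ^ k) {{m^n≢0 p k}}) ⟩
      p * (p * p ^ k)   ≤⟨ pᵏ≤b ⟩
      b                 ∎)
    f≡0 : ∀ k → f (p ^ suc k) ≡ 0
    f≡0 k = ι-no (a <? p ^ suc k ×-dec p ^ suc k ≤? b) (outside k)

-- The factorial ratio

-- The primed lists hold the cofactors d = 900 / a, for which ⌊a t / q⌋ = ⌊⌊900 t / q⌋ / d⌋.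
numerators denominators numerators′ denominators′ : List ℕ
numerators   = 180 ∷ 75 ∷ 50 ∷ 18 ∷ 12 ∷ 1 ∷ []
denominators = 150 ∷ 90 ∷ 60 ∷ 36 ∷ []
numerators′   = 5 ∷ 12 ∷ 18 ∷ 50 ∷ 75 ∷ 900 ∷ []
denominators′ = 6 ∷ 10 ∷ 15 ∷ 25 ∷ []

factorials : List ℕ → ℕ → ℕ
factorials as t = product (map (λ a → (a * t) !) as)

floors : List ℕ → ℕ → ℕ
floors ds m = sum (map (m ÷_) ds)

Complementary : ℕ → ℕ → ℕ → Set
Complementary X a d = a * d ≡ X

numerators-complementary : Pointwise (Complementary 900) numerators numerators′
numerators-complementary = refl ∷ refl ∷ refl ∷ refl ∷ refl ∷ refl ∷ []

denominators-complementary : Pointwise (Complementary 900) denominators denominators′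
denominators-complementary = refl ∷ refl ∷ refl ∷ refl ∷ []

mangoldt-factorials : ∀ N as t → sum as * t ≤ N →
  mangoldt N (λ q → sum (map (λ a → (a * t) ÷ q) as)) ≡ factorials as t
mangoldt-factorials N [] t _ = mangoldt-0 N (λ _ → 0) λ _ → refl
mangoldt-factorials N (a ∷ as) t a+as≤N = trans
  (mangoldt-+ N ((a * t) ÷_) (λ q → sum (map (λ a → (a * t) ÷ q) as)))
  (cong₂ _*_ (mangoldt-! N (a * t) (m+n≤o⇒m≤o (a * t) at+ast≤N))
             (mangoldt-factorials N as t (m+n≤o⇒n≤o (a * t) at+ast≤N)))
  where
  at+ast≤N : a * t + sum as * t ≤ N
  at+ast≤N = subst (_≤ N) (*-distribʳ-+ t a (sum as)) a+as≤N

module _ {X} .{{_ : NonZero X}} where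

  -- Nested floor divisions commute. All the floors at `q` thereby become functions of the single
  -- integer `(X * t) ÷ q`.
  ÷-rescale : ∀ a d → Complementary X a d → ∀ t q → (a * t) ÷ q ≡ ((X * t) ÷ q) ÷ d
  ÷-rescale a zero ad≡X t q = contradiction (trans (sym ad≡X) (*-zeroʳ a)) (≢-nonZero⁻¹ X)
  ÷-rescale a (suc _) ad≡X t zero = refl
  ÷-rescale a d@(suc _) ad≡X t q@(suc _) = begin
    a * t / q             ≡⟨ /-congˡ (m*n/n≡m (a * t) d) ⟨
    a * t * d / d / q     ≡⟨ m/n/o≡m/[n*o] (a * t * d) d q ⟩
    a * t * d / (d * q)   ≡⟨ /-congʳ {m = a * t * d} (*-comm d q) ⟩
    a * t * d / (q * d)   ≡⟨ m/n/o≡m/[n*o] (a * t * d) q d ⟨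
    a * t * d / q / d     ≡⟨ cong (λ z → z / q / d) at*d≡Xt ⟩
    X * t / q / d         ∎
    where
    open ≡-Reasoning
    at*d≡Xt : a * t * d ≡ X * t
    at*d≡Xt = begin
      a * t * d     ≡⟨ *-assoc a t d ⟩
      a * (t * d)   ≡⟨ cong (a *_) (*-comm t d) ⟩
      a * (d * t)   ≡⟨ *-assoc a d t ⟨
      a * d * t     ≡⟨ cong (_* t) ad≡X ⟩
      X * t         ∎

  floors-rescale : ∀ {as ds} → Pointwise (Complementary X) as ds → ∀ t q →
    sum (map (λ a → (a * t) ÷ q) as) ≡ floors ds ((X * t) ÷ q)
  floors-rescale [] t q = refl
  floors-rescale {a ∷ _} {d ∷ _} (ad≡X ∷ pw) t q = cong₂ _+_ (÷-rescale a d ad≡X t q) (floors-rescale pw t q)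

  ÷-period : ∀ a d → Complementary X a d → ∀ r k → (r + k * X) ÷ d ≡ r ÷ d + k * a
  ÷-period a zero ad≡X r k = contradiction (trans (sym ad≡X) (*-zeroʳ a)) (≢-nonZero⁻¹ X)
  ÷-period a d@(suc _) ad≡X r k = begin
    (r + k * X) / d           ≡⟨ cong (λ z → (r + z) / d) (trans (cong (k *_) (sym ad≡X)) (sym (*-assoc k a d))) ⟩
    (r + k * a * d) / d       ≡⟨ +-distrib-/-∣ʳ r (n∣m*n (k * a)) ⟩
    r / d + k * a * d / d     ≡⟨ cong (r / d +_) (m*n/n≡m (k * a) d) ⟩
    r / d + k * a             ∎
    where open ≡-Reasoning

  -- Two lists with equal sums shift by the same amount, so the difference of their floor sums has
  -- period `X`.
  floors-period : ∀ {as ds} → Pointwise (Complementary X) as ds → ∀ r k →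
    floors ds (r + k * X) ≡ floors ds r + k * sum as
  floors-period [] r k = sym (*-zeroʳ k)
  floors-period {a ∷ as} {d ∷ ds} (ad≡X ∷ pw) r k = begin
    (r + k * X) ÷ d + floors ds (r + k * X)
      ≡⟨ cong₂ _+_ (÷-period a d ad≡X r k) (floors-period pw r k) ⟩
    (r ÷ d + k * a) + (floors ds r + k * sum as)
      ≡⟨ arith (r ÷ d) (floors ds r) k a (sum as) ⟩
    (r ÷ d + floors ds r) + k * (a + sum as) ∎
    where
    open ≡-Reasoning
    arith : ∀ x y k a b → (x + k * a) + (y + k * b) ≡ (x + y) + k * (a + b)
    arith = solve-∀

-- Checked by evaluation over one period. At 5 the only nonzero floor is 5 ÷ 5, since all cofactors
-- in `denominators′` exceed 5.
floors-residues : ∀ {r} → r < 900 → floors numerators′ r ≤ floors denominators′ r + ι (r ≟ 5)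
floors-residues = toWitness
  {a? = allUpTo? (λ r → floors numerators′ r ≤? floors denominators′ r + ι (r ≟ 5)) 900} _

-- Both lists sum to 336, so a shift by whole periods preserves the comparison of residues. Later
-- recurrences of the residue 5 are paid for by `ι (900 ≤? m)`.
floors-compare : ∀ m → floors numerators′ m ≤ floors denominators′ m + (ι (m ≟ 5) + ι (900 ≤? m))
floors-compare m = subst
  (λ z → floors numerators′ z ≤ floors denominators′ z + (ι (z ≟ 5) + ι (900 ≤? z)))
  (sym (m≡m%n+[m/n]*n m 900)) (shifted (m % 900) (m%n<n m 900) (m / 900))
  where
  open ≤-Reasoning
  shifted : ∀ r → r < 900 → ∀ k → floors numerators′ (r + k * 900) ≤
    floors denominators′ (r + k * 900) + (ι (r + k * 900 ≟ 5) + ι (900 ≤? r + k * 900))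
  shifted r r<900 zero = subst
    (λ z → floors numerators′ z ≤ floors denominators′ z + (ι (z ≟ 5) + ι (900 ≤? z)))
    (sym (+-identityʳ r))
    (≤-trans (floors-residues r<900) (+-monoʳ-≤ (floors denominators′ r) (m≤m+n _ _)))
  shifted r r<900 k@(suc k′) = begin
    floors numerators′ m′
      ≡⟨ floors-period numerators-complementary r k ⟩
    floors numerators′ r + k * 336
      ≤⟨ +-monoˡ-≤ (k * 336)
           (≤-trans (floors-residues r<900) (+-monoʳ-≤ (floors denominators′ r) (ι≤1 (r ≟ 5)))) ⟩
    floors denominators′ r + 1 + k * 336
      ≡⟨ trans (+-assoc (floors denominators′ r) 1 (k * 336))
           (trans (cong (floors denominators′ r +_) (+-comm 1 (k * 336)))
                  (sym (+-assoc (floors denominators′ r) (k * 336) 1))) ⟩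
    floors denominators′ r + k * 336 + 1
      ≡⟨ cong₂ _+_ (floors-period denominators-complementary r k) (ι-yes (900 ≤? m′) 900≤m′) ⟨
    floors denominators′ m′ + ι (900 ≤? m′)
      ≤⟨ +-monoʳ-≤ (floors denominators′ m′) (m≤n+m _ _) ⟩
    floors denominators′ m′ + (ι (m′ ≟ 5) + ι (900 ≤? m′)) ∎
    where
    m′ = r + k * 900
    900≤m′ : 900 ≤ m′
    900≤m′ = ≤-trans (m≤m+n 900 (k′ * 900)) (m≤n+m (k * 900) r)

-- With `m = (900 * t) ÷ q`, the case `m ≡ 5` means `5 * q ≤ 900 * t < 6 * q`, and `900 ≤ m` forces
-- `q ≤ t`.
floors-compare-at : ∀ t q → .{{NonZero q}} →
  sum (map (λ a → (a * t) ÷ q) numerators) ≤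
  sum (map (λ a → (a * t) ÷ q) denominators) +
    (ι (150 * t <? q ×-dec q ≤? 180 * t) + ι (q ≤? t))
floors-compare-at t q@(suc _) = begin
  sum (map (λ a → (a * t) ÷ q) numerators)
    ≡⟨ floors-rescale numerators-complementary t q ⟩
  floors numerators′ m
    ≤⟨ floors-compare m ⟩
  floors denominators′ m + (ι (m ≟ 5) + ι (900 ≤? m))
    ≤⟨ +-monoʳ-≤ (floors denominators′ m) (+-mono-≤
         (ι-mono (m ≟ 5) (150 * t <? q ×-dec q ≤? 180 * t) λ m≡5 → 150t<q m≡5 , q≤180t m≡5)
         (ι-mono (900 ≤? m) (q ≤? t) q≤t)) ⟩
  floors denominators′ m + (ι (150 * t <? q ×-dec q ≤? 180 * t) + ι (q ≤? t))
    ≡⟨ cong (_+ (ι (150 * t <? q ×-dec q ≤? 180 * t) + ι (q ≤? t)))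
         (floors-rescale denominators-complementary t q) ⟨
  sum (map (λ a → (a * t) ÷ q) denominators) + (ι (150 * t <? q ×-dec q ≤? 180 * t) + ι (q ≤? t)) ∎
  where
  open ≤-Reasoning
  m = (900 * t) ÷ q
  150t<q : m ≡ 5 → 150 * t < q
  150t<q m≡5 = ≰⇒> λ q≤150t → contradiction
    (k*q≤m⇒k≤m/q 6 q (900 * t) (≤-trans (*-monoʳ-≤ 6 q≤150t) (≤-reflexive (sym (*-assoc 6 150 t)))))
    (<⇒≱ (≤-reflexive (cong suc m≡5)))
  q≤180t : m ≡ 5 → q ≤ 180 * t
  q≤180t m≡5 = *-cancelˡ-≤ 5 (begin
    5 * q           ≡⟨ cong (_* q) m≡5 ⟨
    m * q           ≤⟨ m/n*n≤m (900 * t) q ⟩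
    900 * t         ≡⟨ *-assoc 5 180 t ⟩
    5 * (180 * t)   ∎)
  q≤t : 900 ≤ m → q ≤ t
  q≤t 900≤m = *-cancelˡ-≤ 900 (≤-trans (*-monoˡ-≤ q 900≤m) (m/n*n≤m (900 * t) q))

factorials-compare : ∀ t → let N = 336 * t in
  factorials numerators t ≤ factorials denominators t *
    (mangoldt N (λ q → ι (150 * t <? q ×-dec q ≤? 180 * t)) * Ψ N t)
factorials-compare t = begin
  factorials numerators t
    ≡⟨ mangoldt-factorials N numerators t ≤-refl ⟨
  mangoldt N (λ q → sum (map (λ a → (a * t) ÷ q) numerators))
    ≤⟨ mangoldt-mono N (λ q → floors-compare-at t q) ⟩
  mangoldt N (λ q → f q + (g q + h q))
    ≡⟨ mangoldt-+ N f (λ q → g q + h q) ⟩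
  mangoldt N f * mangoldt N (λ q → g q + h q)
    ≡⟨ cong₂ _*_ (mangoldt-factorials N denominators t ≤-refl) (mangoldt-+ N g h) ⟩
  factorials denominators t * (mangoldt N g * Ψ N t) ∎
  where
  open ≤-Reasoning
  N = 336 * t
  f g h : ℕ → ℕ
  f q = sum (map (λ a → (a * t) ÷ q) denominators)
  g q = ι (150 * t <? q ×-dec q ≤? 180 * t)
  h q = ι (q ≤? t)

^-distribʳ-* : ∀ m n k → (m * n) ^ k ≡ m ^ k * n ^ k
^-distribʳ-* m n zero = refl
^-distribʳ-* m n (suc k) = trans (cong (m * n *_) (^-distribʳ-* m n k)) (*-interchange m n (m ^ k) (n ^ k))

^-split : ∀ x t a b → x ^ ((a + b) * t) ≡ x ^ (a * t) * x ^ (b * t)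
^-split x t a b = trans (cong (x ^_) (*-distribʳ-+ t a b)) (^-distribˡ-+-* x (a * t) (b * t))

-- Stirling's formula

-- Bernoulli's inequality (1 - 1/(a + 1)) ^ k ≥ 1 - k/(a + 1), cleared of denominators and
-- subtraction.
bernoulli-lower : ∀ a k → suc a ^ k * suc a ≤ a ^ k * suc a + k * suc a ^ k
bernoulli-lower a zero = ≤-reflexive (sym (+-identityʳ _))
bernoulli-lower a (suc k) = begin
  suc a * suc a ^ k * suc a
    ≡⟨ *-assoc (suc a) (suc a ^ k) (suc a) ⟩
  suc a * (suc a ^ k * suc a)
    ≤⟨ *-monoʳ-≤ (suc a) (bernoulli-lower a k) ⟩
  suc a * (a ^ k * suc a + k * suc a ^ k)
    ≡⟨ arith₁ a (a ^ k) (suc a ^ k) k ⟩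
  a ^ k * suc a + (a * a ^ k * suc a + suc a * (k * suc a ^ k))
    ≤⟨ +-monoˡ-≤ _ (*-monoˡ-≤ (suc a) (^-monoˡ-≤ k (n≤1+n a))) ⟩
  suc a ^ k * suc a + (a * a ^ k * suc a + suc a * (k * suc a ^ k))
    ≡⟨ arith₂ a (a ^ k) (suc a ^ k) k ⟩
  a * a ^ k * suc a + suc k * (suc a * suc a ^ k) ∎
  where
  open ≤-Reasoning
  arith₁ : ∀ a x y k → suc a * (x * suc a + k * y) ≡ x * suc a + (a * x * suc a + suc a * (k * y))
  arith₁ = solve-∀
  arith₂ : ∀ a x y k → y * suc a + (a * x * suc a + suc a * (k * y)) ≡ a * x * suc a + suc k * (suc a * y)
  arith₂ = solve-∀

-- Bernoulli's inequality (1 + 1/a) ^ k ≥ 1 + k/a, cleared of denominators.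
bernoulli-upper : ∀ a k → a ^ k * (a + k) ≤ suc a ^ k * a
bernoulli-upper a zero = *-monoʳ-≤ 1 (≤-reflexive (+-identityʳ a))
bernoulli-upper a (suc k) = begin
  a * a ^ k * (a + suc k)             ≤⟨ m≤m+n _ (a ^ k * k) ⟩
  a * a ^ k * (a + suc k) + a ^ k * k ≡⟨ arith a (a ^ k) k ⟩
  suc a * (a ^ k * (a + k))           ≤⟨ *-monoʳ-≤ (suc a) (bernoulli-upper a k) ⟩
  suc a * (suc a ^ k * a)             ≡⟨ *-assoc (suc a) (suc a ^ k) a ⟨
  suc a * suc a ^ k * a               ∎
  where
  open ≤-Reasoning
  arith : ∀ a x k → a * x * (a + suc k) + x * k ≡ suc a * (x * (a + k))
  arith = solve-∀

Fraction : Set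
Fraction = ℕ × ℕ

infix 4 _≼_
record _≼_ (x y : Fraction) : Set where
  constructor cross
  field
    cross-≤ : proj₁ x * proj₂ y ≤ proj₁ y * proj₂ x

open _≼_

≼-trans : ∀ {x y z} → .{{NonZero (proj₂ y)}} → x ≼ y → y ≼ z → x ≼ z
≼-trans {a , b} {c , d} {e , f} (cross ad≤cb) (cross cf≤ed) = cross (*-cancelʳ-≤ (a * f) (e * b) d (begin
  a * f * d   ≡⟨ arith a f d ⟩
  a * d * f   ≤⟨ *-monoˡ-≤ f ad≤cb ⟩
  c * b * f   ≡⟨ arith c b f ⟩
  c * f * b   ≤⟨ *-monoˡ-≤ b cf≤ed ⟩
  e * d * b   ≡⟨ arith e d b ⟩
  e * b * d   ∎))
  where
  open ≤-Reasoning
  arith : ∀ x y z → x * y * z ≡ x * z * y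
  arith = solve-∀

-- (1 + 1/n) ^ n increases to e and (1 + 1/n) ^ (n + 1) decreases to e.
e⁻ e⁺ : ℕ → Fraction
e⁻ n = suc n ^ n , n ^ n
e⁺ n = suc n ^ suc n , n ^ suc n

suc[n*[n+2]]≡[n+1]² : ∀ n → suc (n * suc (suc n)) ≡ suc n * suc n
suc[n*[n+2]]≡[n+1]² = solve-∀

-- The quotient of the two sides is (n(n + 2)/(n + 1)²) ^ (n + 1) · (n + 1)/n, and Bernoulli bounds
-- the power below by n/(n + 1).
e⁻-step : ∀ n → e⁻ n ≼ e⁻ (suc n)
e⁻-step zero = cross (s≤s z≤n)
e⁻-step n@(suc _) = cross (*-cancelˡ-≤ (n * suc n) (+-cancelʳ-≤ (b ^ suc n) _ _ (begin
  n * suc n * (suc n ^ n * suc n ^ suc n) + b ^ suc n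
    ≡⟨ cong (_+ b ^ suc n) (trans (arith₁ n (suc n ^ n) (suc n ^ suc n))
         (cong (n *_) (sym (^-distribʳ-* (suc n) (suc n) (suc n))))) ⟩
  n * b ^ suc n + b ^ suc n
    ≡⟨ +-comm (n * b ^ suc n) (b ^ suc n) ⟩
  suc n * b ^ suc n
    ≤⟨ *-cancelʳ-≤ _ _ (suc n) bernoulli ⟩
  suc n * a ^ suc n + b ^ suc n
    ≡⟨ cong (_+ b ^ suc n) (trans (cong (suc n *_) (^-distribʳ-* n (suc (suc n)) (suc n)))
         (arith₂ n (n ^ n) (suc (suc n) ^ suc n))) ⟩
  n * suc n * (suc (suc n) ^ suc n * n ^ n) + b ^ suc n ∎)))
  where
  open ≤-Reasoning
  a b : ℕ
  a = n * suc (suc n)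
  b = suc n * suc n
  arith₁ : ∀ n x y → n * suc n * (x * y) ≡ n * (suc n * x * y)
  arith₁ = solve-∀
  arith₂ : ∀ n x y → suc n * (n * x * y) ≡ n * suc n * (y * x)
  arith₂ = solve-∀
  arith₃ : ∀ n x → suc n * x * suc n ≡ x * (suc n * suc n)
  arith₃ = solve-∀
  arith₄ : ∀ n x y → x * (suc n * suc n) + suc n * y ≡ (suc n * x + y) * suc n
  arith₄ = solve-∀
  bernoulli : suc n * b ^ suc n * suc n ≤ (suc n * a ^ suc n + b ^ suc n) * suc n
  bernoulli = begin
    suc n * b ^ suc n * suc n                 ≡⟨ arith₃ n (b ^ suc n) ⟩
    b ^ suc n * b                             ≤⟨ subst (λ z → z ^ suc n * z ≤ a ^ suc n * z + suc n * z ^ suc n)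
                                                   (suc[n*[n+2]]≡[n+1]² n) (bernoulli-lower a (suc n)) ⟩
    a ^ suc n * b + suc n * b ^ suc n         ≡⟨ arith₄ n (a ^ suc n) (b ^ suc n) ⟩
    (suc n * a ^ suc n + b ^ suc n) * suc n   ∎

e⁺-step : ∀ n → .{{NonZero n}} → e⁺ (suc n) ≼ e⁺ n
e⁺-step n@(suc _) = cross (begin
  suc (suc n) * suc (suc n) ^ suc n * n ^ suc n
    ≡⟨ trans (arith₁ (suc (suc n)) (suc (suc n) ^ suc n) (n ^ suc n))
             (cong (_* suc (suc n)) (sym (^-distribʳ-* n (suc (suc n)) (suc n)))) ⟩
  a ^ suc n * suc (suc n)
    ≤⟨ *-cancelʳ-≤ _ _ a bernoulli ⟩
  b ^ suc n * suc n
    ≡⟨ trans (cong (_* suc n) (^-distribʳ-* (suc n) (suc n) (suc n)))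
             (arith₂ (suc n) (suc n ^ suc n)) ⟩
  suc n ^ suc n * (suc n * suc n ^ suc n) ∎)
  where
  open ≤-Reasoning
  a b : ℕ
  a = n * suc (suc n)
  b = suc n * suc n
  arith₁ : ∀ m x y → m * x * y ≡ y * x * m
  arith₁ = solve-∀
  arith₂ : ∀ m x → x * x * m ≡ x * (m * x)
  arith₂ = solve-∀
  arith₃ : ∀ n x → x * suc (suc n) * (n * suc (suc n)) + x ≡ x * (n * suc (suc n) + suc n) * suc n
  arith₃ = solve-∀
  arith₄ : ∀ x a m → x * a * m ≡ x * m * a
  arith₄ = solve-∀
  bernoulli : a ^ suc n * suc (suc n) * a ≤ b ^ suc n * suc n * a
  bernoulli = begin
    -- The added term reflects (n + 1)(a + n + 1) = (n + 2)a + 1.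
    a ^ suc n * suc (suc n) * a               ≤⟨ m≤m+n _ (a ^ suc n) ⟩
    a ^ suc n * suc (suc n) * a + a ^ suc n   ≡⟨ arith₃ n (a ^ suc n) ⟩
    a ^ suc n * (a + suc n) * suc n           ≤⟨ *-monoˡ-≤ (suc n) (bernoulli-upper a (suc n)) ⟩
    suc a ^ suc n * a * suc n                 ≡⟨ cong (λ z → z ^ suc n * a * suc n) (suc[n*[n+2]]≡[n+1]² n) ⟩
    b ^ suc n * a * suc n                     ≡⟨ arith₄ (b ^ suc n) a (suc n) ⟩
    b ^ suc n * suc n * a                     ∎

n^n≢0 : ∀ n → NonZero (n ^ n)
n^n≢0 zero = _
n^n≢0 n@(suc _) = m^n≢0 n n

e⁻-mono : ∀ {m n} → m ≤′ n → e⁻ m ≼ e⁻ n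
e⁻-mono ≤′-refl = cross ≤-refl
e⁻-mono {n = suc n} (≤′-step m≤n) = ≼-trans {{n^n≢0 n}} (e⁻-mono m≤n) (e⁻-step n)

e⁺-anti : ∀ {m n} → .{{NonZero m}} → m ≤′ n → e⁺ n ≼ e⁺ m
e⁺-anti ≤′-refl = cross ≤-refl
e⁺-anti {n = suc zero} (≤′-step ≤′-refl) = cross z≤n
e⁺-anti {n = suc n@(suc _)} (≤′-step m≤n) = ≼-trans {{m^n≢0 n (suc n)}} (e⁺-step n) (e⁺-anti m≤n)

e⁻≼e⁺-diagonal : ∀ n → e⁻ n ≼ e⁺ n
e⁻≼e⁺-diagonal n = cross (begin
  suc n ^ n * (n * n ^ n)       ≡⟨ x∙yz≈y∙xz (suc n ^ n) n (n ^ n) ⟩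
  n * (suc n ^ n * n ^ n)       ≤⟨ *-monoˡ-≤ _ (n≤1+n n) ⟩
  suc n * (suc n ^ n * n ^ n)   ≡⟨ *-assoc (suc n) (suc n ^ n) (n ^ n) ⟨
  suc n * suc n ^ n * n ^ n     ∎)
  where open ≤-Reasoning

-- Both are compared at the larger index. This lets rational bounds stand in for the number e.
e⁻≼e⁺ : ∀ m n → .{{NonZero n}} → e⁻ m ≼ e⁺ n
e⁻≼e⁺ m n with ≤-total m n
... | inj₁ m≤n = ≼-trans {{n^n≢0 n}} (e⁻-mono (≤⇒≤′ m≤n)) (e⁻≼e⁺-diagonal n)
... | inj₂ n≤m = ≼-trans {{m^n≢0 m (suc m) {{m≢0}}}} (e⁻≼e⁺-diagonal m) (e⁺-anti (≤⇒≤′ n≤m))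
  where
  m≢0 : NonZero m
  m≢0 = >-nonZero (≤-trans (>-nonZero⁻¹ n) n≤m)

powers : List ℕ → ℕ → ℕ
powers as t = product (map (λ a → (a * t) ^ (a * t)) as)

self-powers : List ℕ → ℕ
self-powers as = product (map (λ a → a ^ a) as)

-- Isolates the power of `t`, which cancels between two lists with the same sum.
powers-split : ∀ as t → powers as t ≡ self-powers as ^ t * t ^ (sum as * t)
powers-split [] t = sym (trans (*-identityʳ (1 ^ t)) (^-zeroˡ t))
powers-split (a ∷ as) t = begin
  (a * t) ^ (a * t) * powers as t
    ≡⟨ cong₂ _*_ (trans (^-distribʳ-* a t (a * t)) (cong (_* t ^ (a * t)) (sym (^-*-assoc a a t))))
                 (powers-split as t) ⟩
  (a ^ a) ^ t * t ^ (a * t) * (self-powers as ^ t * t ^ (sum as * t))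
    ≡⟨ *-interchange ((a ^ a) ^ t) (t ^ (a * t)) (self-powers as ^ t) _ ⟩
  (a ^ a) ^ t * self-powers as ^ t * (t ^ (a * t) * t ^ (sum as * t))
    ≡⟨ cong₂ _*_ (^-distribʳ-* (a ^ a) (self-powers as) t)
         (^-split t t a (sum as)) ⟨
  (a ^ a * self-powers as) ^ t * t ^ ((a + sum as) * t) ∎
  where open ≡-Reasoning

-- Collects the factors `4 * n` lost in `stirling-upper`.
slack : List ℕ → ℕ → ℕ
slack as t = product (map (λ a → 4 * (a * t)) as)

module Stirling (K : ℕ) .{{_ : NonZero K}} where

  -- `d / c` is `e⁻ K`, and `(suc K * d) / (K * c)` is `e⁺ K`.
  c d : ℕ
  c = K ^ K
  d = suc K ^ K

  -- That is, n! ≥ (n / `e⁺ K`) ^ n: from `n` to `n + 1` the power n ^ n grows by the factor (n + 1)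
  -- · `e⁻ n`, at most (n + 1) · `e⁺ K`.
  stirling-lower : ∀ n → n ^ n * (K * c) ^ n ≤ n ! * (suc K * d) ^ n
  stirling-lower zero = ≤-refl
  stirling-lower (suc n) = begin
    suc n * suc n ^ n * (K * c * (K * c) ^ n)
      ≡⟨ arith₁ (suc n) (suc n ^ n) (K * c) ((K * c) ^ n) ⟩
    suc n * (suc n ^ n * (K * c)) * (K * c) ^ n
      ≤⟨ *-monoˡ-≤ ((K * c) ^ n) (*-monoʳ-≤ (suc n) (cross-≤ (e⁻≼e⁺ n K))) ⟩
    suc n * (suc K * d * n ^ n) * (K * c) ^ n
      ≡⟨ arith₂ (suc n) (suc K * d) (n ^ n) ((K * c) ^ n) ⟩
    suc n * (suc K * d) * (n ^ n * (K * c) ^ n)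
      ≤⟨ *-monoʳ-≤ (suc n * (suc K * d)) (stirling-lower n) ⟩
    suc n * (suc K * d) * (n ! * (suc K * d) ^ n)
      ≡⟨ *-interchange (suc n) (suc K * d) (n !) ((suc K * d) ^ n) ⟩
    suc n * n ! * (suc K * d * (suc K * d) ^ n) ∎
    where
    open ≤-Reasoning
    arith₁ : ∀ m x y z → m * x * (y * z) ≡ m * (x * y) * z
    arith₁ = solve-∀
    arith₂ : ∀ m x y z → m * (x * y) * z ≡ m * x * (y * z)
    arith₂ = solve-∀

  -- That is, n! ≤ 4n (n / `e⁻ K`) ^ n. Here n · n ^ n grows by (n + 1) · `e⁺ n`, at least (n + 1) ·
  -- `e⁻ K`; the constant 4 is `e⁺ 1`, needed at `n = 1`.
  stirling-upper : ∀ n → .{{NonZero n}} → n ! * d ^ n ≤ 4 * n * (n ^ n * c ^ n)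
  stirling-upper (suc zero) = begin
    1 * (d * 1)       ≡⟨ *-identityˡ (d * 1) ⟩
    d * 1             ≤⟨ cross-≤ (e⁻≼e⁺ K 1) ⟩
    4 * c             ≡⟨ arith c ⟩
    4 * (1 * (c * 1)) ∎
    where
    open ≤-Reasoning
    arith : ∀ c → 4 * c ≡ 4 * (1 * (c * 1))
    arith = solve-∀
  stirling-upper (suc n@(suc _)) = begin
    suc n * n ! * (d * d ^ n)
      ≡⟨ *-interchange (suc n) (n !) d (d ^ n) ⟩
    suc n * d * (n ! * d ^ n)
      ≤⟨ *-monoʳ-≤ (suc n * d) (stirling-upper n) ⟩
    suc n * d * (4 * n * (n ^ n * c ^ n))
      ≡⟨ arith₁ n d (n ^ n) (c ^ n) ⟩
    4 * suc n * c ^ n * (d * (n * n ^ n))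
      ≤⟨ *-monoʳ-≤ (4 * suc n * c ^ n) (cross-≤ (e⁻≼e⁺ K n)) ⟩
    4 * suc n * c ^ n * (suc n ^ suc n * c)
      ≡⟨ arith₂ n (c ^ n) (suc n ^ suc n) c ⟩
    4 * suc n * (suc n ^ suc n * (c * c ^ n)) ∎
    where
    open ≤-Reasoning
    arith₁ : ∀ n d x y → suc n * d * (4 * n * (x * y)) ≡ 4 * suc n * y * (d * (n * x))
    arith₁ = solve-∀
    arith₂ : ∀ n y z c → 4 * suc n * y * (z * c) ≡ 4 * suc n * (z * (c * y))
    arith₂ = solve-∀

  factorials-lower : ∀ as t →
    powers as t * (K * c) ^ (sum as * t) ≤ factorials as t * (suc K * d) ^ (sum as * t)
  factorials-lower [] t = ≤-refl
  factorials-lower (a ∷ as) t = begin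
    (a * t) ^ (a * t) * powers as t * (K * c) ^ ((a + sum as) * t)
      ≡⟨ cong ((a * t) ^ (a * t) * powers as t *_) (^-split (K * c) t a (sum as)) ⟩
    (a * t) ^ (a * t) * powers as t * ((K * c) ^ (a * t) * (K * c) ^ (sum as * t))
      ≡⟨ *-interchange ((a * t) ^ (a * t)) (powers as t) _ _ ⟩
    (a * t) ^ (a * t) * (K * c) ^ (a * t) * (powers as t * (K * c) ^ (sum as * t))
      ≤⟨ *-mono-≤ (stirling-lower (a * t)) (factorials-lower as t) ⟩
    (a * t) ! * (suc K * d) ^ (a * t) * (factorials as t * (suc K * d) ^ (sum as * t))
      ≡⟨ *-interchange ((a * t) !) _ (factorials as t) _ ⟩
    (a * t) ! * factorials as t * ((suc K * d) ^ (a * t) * (suc K * d) ^ (sum as * t))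
      ≡⟨ cong ((a * t) ! * factorials as t *_) (^-split (suc K * d) t a (sum as)) ⟨
    (a * t) ! * factorials as t * (suc K * d) ^ ((a + sum as) * t) ∎
    where open ≤-Reasoning

  factorials-upper : ∀ {as} → All NonZero as → ∀ t → .{{NonZero t}} →
    factorials as t * d ^ (sum as * t) ≤ slack as t * (powers as t * c ^ (sum as * t))
  factorials-upper [] t = ≤-refl
  factorials-upper {a ∷ as} (a≢0 ∷ as≢0) t = begin
    (a * t) ! * factorials as t * d ^ ((a + sum as) * t)
      ≡⟨ cong ((a * t) ! * factorials as t *_) (^-split d t a (sum as)) ⟩
    (a * t) ! * factorials as t * (d ^ (a * t) * d ^ (sum as * t))
      ≡⟨ *-interchange ((a * t) !) (factorials as t) _ _ ⟩
    (a * t) ! * d ^ (a * t) * (factorials as t * d ^ (sum as * t))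
      ≤⟨ *-mono-≤ (stirling-upper (a * t) {{m*n≢0 a t {{a≢0}}}}) (factorials-upper as≢0 t) ⟩
    4 * (a * t) * ((a * t) ^ (a * t) * c ^ (a * t)) * (slack as t * (powers as t * c ^ (sum as * t)))
      ≡⟨ arith (4 * (a * t)) ((a * t) ^ (a * t)) (c ^ (a * t)) (slack as t) (powers as t) (c ^ (sum as * t)) ⟩
    4 * (a * t) * slack as t * ((a * t) ^ (a * t) * powers as t * (c ^ (a * t) * c ^ (sum as * t)))
      ≡⟨ cong (λ z → 4 * (a * t) * slack as t * ((a * t) ^ (a * t) * powers as t * z)) (^-split c t a (sum as)) ⟨
    4 * (a * t) * slack as t * ((a * t) ^ (a * t) * powers as t * c ^ ((a + sum as) * t)) ∎
    where
    open ≤-Reasoning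
    arith : ∀ u x y v z w → u * (x * y) * (v * (z * w)) ≡ u * v * (x * z * (y * w))
    arith = solve-∀

  -- Stirling from below for `as` and from above for `bs`. Equal sums cancel the powers of `t`, and
  -- of e only the ratio `suc K / K` of its two bounds survives.
  ratio-bound : ∀ {as bs} S → sum as ≡ S → sum bs ≡ S → All NonZero bs → ∀ t → .{{NonZero t}} → ∀ G →
    factorials as t ≤ factorials bs t * G →
    (self-powers as * K ^ S) ^ t ≤ slack bs t * G * (self-powers bs * suc K ^ S) ^ t
  ratio-bound {as} {bs} S refl Σbs≡S bs≢0 t G as≤bs*G = begin
    (self-powers as * K ^ S) ^ t
      ≡⟨ expand (self-powers as) K ⟩
    self-powers as ^ t * K ^ St
      ≤⟨ *-cancelˡ-≤ (t ^ St * c ^ St) {{m*n≢0 _ _ {{m^n≢0 t St}} {{m^n≢0 c St {{n^n≢0 K}}}}}} cancelled ⟩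
    slack bs t * G * (self-powers bs ^ t * suc K ^ St)
      ≡⟨ cong (slack bs t * G *_) (expand (self-powers bs) (suc K)) ⟨
    slack bs t * G * (self-powers bs * suc K ^ S) ^ t ∎
    where
    open ≤-Reasoning
    St = S * t
    expand : ∀ x y → (x * y ^ S) ^ t ≡ x ^ t * y ^ St
    expand x y = trans (^-distribʳ-* x (y ^ S) t) (cong (x ^ t *_) (^-*-assoc y S t))
    upper : factorials bs t * d ^ St ≤ slack bs t * (powers bs t * c ^ St)
    upper = subst (λ z → factorials bs t * d ^ (z * t) ≤ slack bs t * (powers bs t * c ^ (z * t)))
              Σbs≡S (factorials-upper bs≢0 t)
    bs-split : powers bs t ≡ self-powers bs ^ t * t ^ St
    bs-split = trans (powers-split bs t) (cong (λ z → self-powers bs ^ t * t ^ (z * t)) Σbs≡S)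
    arith₁ : ∀ x y z w → x * y * (z * w) ≡ z * x * (w * y)
    arith₁ = solve-∀
    arith₂ : ∀ x g y z → x * g * (y * z) ≡ g * y * (x * z)
    arith₂ = solve-∀
    arith₃ : ∀ g k s h x c → g * k * (s * (h * x * c)) ≡ x * c * (s * g * (h * k))
    arith₃ = solve-∀
    cancelled : t ^ St * c ^ St * (self-powers as ^ t * K ^ St) ≤
      t ^ St * c ^ St * (slack bs t * G * (self-powers bs ^ t * suc K ^ St))
    cancelled = begin
      t ^ St * c ^ St * (self-powers as ^ t * K ^ St)
        ≡⟨ arith₁ (t ^ St) (c ^ St) (self-powers as ^ t) (K ^ St) ⟩
      self-powers as ^ t * t ^ St * (K ^ St * c ^ St)
        ≡⟨ cong₂ _*_ (powers-split as t) (^-distribʳ-* K c St) ⟨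
      powers as t * (K * c) ^ St
        ≤⟨ factorials-lower as t ⟩
      factorials as t * (suc K * d) ^ St
        ≤⟨ *-monoˡ-≤ _ as≤bs*G ⟩
      factorials bs t * G * (suc K * d) ^ St
        ≡⟨ cong (factorials bs t * G *_) (^-distribʳ-* (suc K) d St) ⟩
      factorials bs t * G * (suc K ^ St * d ^ St)
        ≡⟨ arith₂ (factorials bs t) G (suc K ^ St) (d ^ St) ⟩
      G * suc K ^ St * (factorials bs t * d ^ St)
        ≤⟨ *-monoʳ-≤ (G * suc K ^ St) upper ⟩
      G * suc K ^ St * (slack bs t * (powers bs t * c ^ St))
        ≡⟨ cong (λ z → G * suc K ^ St * (slack bs t * (z * c ^ St))) bs-split ⟩
      G * suc K ^ St * (slack bs t * (self-powers bs ^ t * t ^ St * c ^ St))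
        ≡⟨ arith₃ G (suc K ^ St) (slack bs t) (self-powers bs ^ t) (t ^ St) (c ^ St) ⟩
      t ^ St * c ^ St * (slack bs t * G * (self-powers bs ^ t * suc K ^ St)) ∎

-- Numerical growth rate and the contradiction for large n

open Stirling 1000 using (ratio-bound)

-- The factorial ratio grows like 115 ^ t; replacing e by e⁻ 1000 and e⁺ 1000 loses (1001/1000) ^ (336 t).
growth : self-powers denominators * 1001 ^ 336 * 64 ≤ self-powers numerators * 1000 ^ 336
growth = ≤ᵇ⇒≤ (self-powers denominators * 1001 ^ 336 * 64) (self-powers numerators * 1000 ^ 336) _

64^t≤ : ∀ t → .{{NonZero t}} → ∀ G → factorials numerators t ≤ factorials denominators t * G →
  64 ^ t ≤ slack denominators t * G
64^t≤ t G num≤den*G = *-cancelˡ-≤ (L ^ t) {{m^n≢0 L t}} (begin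
  L ^ t * 64 ^ t                                    ≡⟨ ^-distribʳ-* L 64 t ⟨
  (L * 64) ^ t                                      ≤⟨ ^-monoˡ-≤ t growth ⟩
  (self-powers numerators * 1000 ^ 336) ^ t         ≤⟨ ratio-bound {numerators} {denominators} 336 refl refl
                                                         (_ ∷ _ ∷ _ ∷ _ ∷ []) t G num≤den*G ⟩
  slack denominators t * G * L ^ t                  ≡⟨ *-comm (slack denominators t * G) (L ^ t) ⟩
  L ^ t * (slack denominators t * G)                ∎)
  where
  open ≤-Reasoning
  L = self-powers denominators * 1001 ^ 336

slack-bound : ∀ t → .{{NonZero t}} → slack denominators t ≤ (180 * t) ^ 8
slack-bound t = begin
  slack denominators t   ≤⟨ *-mono-≤ (factor 150 _) (*-mono-≤ (factor 90 _)
                              (*-mono-≤ (factor 60 _) (*-mono-≤ (factor 36 _) ≤-refl))) ⟩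
  (b ^ 2) ^ 4            ≡⟨ ^-*-assoc b 2 4 ⟩
  b ^ 8                  ∎
  where
  open ≤-Reasoning
  b = 180 * t
  factor : ∀ a → T (a ≤ᵇ 180) → 4 * (a * t) ≤ b ^ 2
  factor a a≤180 = *-mono-≤
    (≤-trans (m≤m+n 4 176) (m≤m*n 180 t))
    (≤-trans (*-monoˡ-≤ t (≤ᵇ⇒≤ a 180 a≤180)) (≤-reflexive (sym (*-identityʳ b))))

-- Of the growth `64 ^ t`, Chebyshev's bound absorbs `4 ^ t`. The exponent adds 8 from Stirling, `s`
-- for the small primes and 150 for the integers just above `150 * t`.
no-primes⇒16^t≤ : ∀ t s → .{{NonZero t}} → 180 * t < s * s →
  (∀ {p} → Prime p → 150 * t + 150 < p → p ≤ 180 * t → ⊥) →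
  16 ^ t ≤ (180 * t) ^ (8 + (s + 150))
no-primes⇒16^t≤ t s b<s² none = *-cancelʳ-≤ _ _ (4 ^ t) {{m^n≢0 4 t}} (begin
  16 ^ t * 4 ^ t                                     ≡⟨ ^-distribʳ-* 16 4 t ⟨
  64 ^ t                                             ≤⟨ 64^t≤ t (gap * Ψ N t) (factorials-compare t) ⟩
  slack denominators t * (gap * Ψ N t)               ≤⟨ *-mono-≤ (slack-bound t) (*-mono-≤ gap≤ (Ψ≤4^ N t (m≤n*m t 336))) ⟩
  b ^ 8 * (b ^ (s + 150) * 4 ^ t)                    ≡⟨ *-assoc (b ^ 8) (b ^ (s + 150)) (4 ^ t) ⟨
  b ^ 8 * b ^ (s + 150) * 4 ^ t                      ≡⟨ cong (_* 4 ^ t) (^-distribˡ-+-* b 8 (s + 150)) ⟨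
  b ^ (8 + (s + 150)) * 4 ^ t                        ∎)
  where
  open ≤-Reasoning
  b = 180 * t
  N = 336 * t
  gap = mangoldt N (λ q → ι (150 * t <? q ×-dec q ≤? b))
  gap≤ : gap ≤ b ^ (s + 150)
  gap≤ = mangoldt-gap N (150 * t) b 150 s {{m*n≢0 180 t}} b<s² none

-- `w` is the integer part of √(t / c), which rises by at most one when `t` does.
scaled-sqrt : ∀ c .{{_ : NonZero c}} t → ∃[ w ] (c * (w * w) ≤ t × t < c * (suc w * suc w))
scaled-sqrt c zero = 0 , ≤-reflexive (*-zeroʳ c) , ≤-trans (>-nonZero⁻¹ c) (m≤m*n c 1)
scaled-sqrt c (suc t) with scaled-sqrt c t
... | w , cw²≤t , t<c[w+1]² with <-≤-connex (suc t) (c * (suc w * suc w))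
...   | inj₁ t+1< = w , m≤n⇒m≤1+n cw²≤t , t+1<
...   | inj₂ ≤t+1 = suc w , ≤t+1 , ≤-<-trans t<c[w+1]² (*-monoʳ-< c (*-mono-< (n<1+n (suc w)) (n<1+n (suc w))))

-- 180 * 1445 = 510², so s = 510 (w + 1) exceeds √(180 t) when t < 1445 (w + 1)².
no-primes⇒⊥-scaled : ∀ t w → 4 ≤ w → 1445 * (w * w) ≤ t → t < 1445 * (suc w * suc w) →
  (∀ {p} → Prime p → 150 * t + 150 < p → p ≤ 180 * t → ⊥) → ⊥
no-primes⇒⊥-scaled t w 4≤w t≥ t< none = <⇒≱ (^-monoʳ-< 2 ≤-refl exponents<) (begin
  2 ^ (4 * t)                                        ≡⟨ ^-*-assoc 2 4 t ⟨
  16 ^ t                                             ≤⟨ no-primes⇒16^t≤ t s {{t≢0}} b<s² none ⟩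
  (180 * t) ^ (8 + (s + 150))                        ≤⟨ ^-monoˡ-≤ (8 + (s + 150)) b≤ ⟩
  (2 ^ (u + u)) ^ (8 + (s + 150))                    ≡⟨ ^-*-assoc 2 (u + u) (8 + (s + 150)) ⟩
  2 ^ ((u + u) * (8 + (s + 150)))                    ∎)
  where
  open ≤-Reasoning
  s u : ℕ
  s = 510 * suc w
  -- Chosen so that `s ≤ 2 ^ u`, from `510 ≤ 2 ^ 9` and `suc w ≤ 2 ^ w`.
  u = 9 + w
  w≢0 : NonZero w
  w≢0 = >-nonZero (≤-trans (s≤s z≤n) 4≤w)
  t≢0 : NonZero t
  t≢0 = >-nonZero (≤-trans (>-nonZero⁻¹ _ {{m*n≢0 1445 (w * w) {{_}} {{m*n≢0 w w {{w≢0}} {{w≢0}}}}}}) t≥)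
  b<s² : 180 * t < s * s
  b<s² = begin-strict
    180 * t                              <⟨ *-monoʳ-< 180 t< ⟩
    180 * (1445 * (suc w * suc w))       ≡⟨ *-assoc 180 1445 (suc w * suc w) ⟨
    180 * 1445 * (suc w * suc w)         ≡⟨ cong (_* (suc w * suc w)) 180*1445≡510² ⟩
    510 * 510 * (suc w * suc w)          ≡⟨ *-interchange 510 510 (suc w) (suc w) ⟩
    s * s                                ∎
    where
    180*1445≡510² : 180 * 1445 ≡ 510 * 510
    180*1445≡510² = refl
  s≤ : s ≤ 2 ^ u
  s≤ = ≤-trans (*-mono-≤ (≤ᵇ⇒≤ 510 (2 ^ 9) _) (n<p^n 2 w ≤-refl)) (≤-reflexive (sym (^-distribˡ-+-* 2 9 w)))
  b≤ : 180 * t ≤ 2 ^ (u + u)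
  b≤ = ≤-trans (<⇒≤ b<s²) (≤-trans (*-mono-≤ s≤ s≤) (≤-reflexive (sym (^-distribˡ-+-* 2 u u))))
  -- Substituting `w = 4 + v` leaves a surplus with nonnegative coefficients; 4 is the least `w` at
  -- which the inequality holds.
  polynomial : ∀ v →
    suc (((9 + (4 + v)) + (9 + (4 + v))) * (8 + (510 * suc (4 + v) + 150)))
      + (4760 * (v * v) + 27564 * v + 22071)
    ≡ 4 * (1445 * ((4 + v) * (4 + v)))
  polynomial = solve-∀
  Dominated : ℕ → Set
  Dominated w = ((9 + w) + (9 + w)) * (8 + (510 * suc w + 150)) < 4 * (1445 * (w * w))
  dominated : ∀ v → Dominated (4 + v)
  dominated v = ≤-trans (m≤m+n _ (4760 * (v * v) + 27564 * v + 22071)) (≤-reflexive (polynomial v))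
  exponents< : (u + u) * (8 + (s + 150)) < 4 * t
  exponents< = <-≤-trans (subst Dominated (m+[n∸m]≡n 4≤w) (dominated (w ∸ 4))) (*-monoʳ-≤ 4 t≥)

-- 23120 = 1445 * 4²
no-primes⇒⊥ : ∀ t → 23120 ≤ t → (∀ {p} → Prime p → 150 * t + 150 < p → p ≤ 180 * t → ⊥) → ⊥
no-primes⇒⊥ t t≥ none with scaled-sqrt 1445 t
... | w , ≤t , t< = no-primes⇒⊥-scaled t w (≮⇒≥ w≮4) ≤t t< none
  where
  w≮4 : ¬ w < 4
  w≮4 w<4 = <⇒≱ t< (≤-trans (*-monoʳ-≤ 1445 (*-mono-≤ w<4 w<4)) t≥)

PrimeBetween : ℕ → Set
PrimeBetween n = ∃[ p ] (Prime p × 5 * n < p × p < 6 * n)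

large : ∀ n → 693600 ≤ n → PrimeBetween n
-- The bounded search decides existence, which makes the argument by contradiction constructive.
large n n≥ with anyUpTo? (λ p → prime? p ×-dec 5 * n <? p) (6 * n)
... | yes (p , p<6n , pp , 5n<p) = p , pp , 5n<p , p<6n
-- `693600 = 30 * 23120`
... | no ¬p = ⊥-elim (no-primes⇒⊥ t (k*q≤m⇒k≤m/q 23120 30 n n≥) none)
  where
  open ≤-Reasoning
  t = n / 30
  5n≤ : 5 * n ≤ 150 * t + 150
  5n≤ = begin
    5 * n                     ≡⟨ cong (5 *_) (m≡m%n+[m/n]*n n 30) ⟩
    5 * (n % 30 + t * 30)     ≤⟨ *-monoʳ-≤ 5 (+-monoˡ-≤ (t * 30) (m%n≤n n 30)) ⟩
    5 * (30 + t * 30)         ≡⟨ arith t ⟩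
    150 * t + 150             ∎
    where
    arith : ∀ t → 5 * (30 + t * 30) ≡ 150 * t + 150
    arith = solve-∀
  180t≤ : 180 * t ≤ 6 * n
  180t≤ = begin
    180 * t        ≡⟨ arith t ⟩
    6 * (t * 30)   ≤⟨ *-monoʳ-≤ 6 (m/n*n≤m n 30) ⟩
    6 * n          ∎
    where
    arith : ∀ t → 180 * t ≡ 6 * (t * 30)
    arith = solve-∀
  -- `180 * t` equals `6 * n` when 30 divides `n`, so the right endpoint has to be excluded.
  ¬prime[6n] : ¬ Prime (6 * n)
  ¬prime[6n] pp = contradiction
    (prime-∣-prime prime[2] pp (∣m⇒∣m*n n (divides 3 refl)))
    (<⇒≢ (≤-trans (m≤m+n 3 3) (m≤m*n 6 n {{>-nonZero (≤-trans (m≤m+n 1 693599) n≥)}})))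
  none : ∀ {p} → Prime p → 150 * t + 150 < p → p ≤ 180 * t → ⊥
  none pp <p p≤ = ¬p (_ , ≤∧≢⇒< (≤-trans p≤ 180t≤) (λ { refl → ¬prime[6n] pp }) , pp , ≤-<-trans 5n≤ <p)

-- Small n

-- Tests the divisors suc d, suc d + 1, … until their square exceeds n, at most k of them.
trial-division : ℕ → ℕ → ℕ → Bool
trial-division zero n d = n <ᵇ suc d * suc d
trial-division (suc k) n d =
  (n <ᵇ suc d * suc d) ∨ (not (n % suc d ≡ᵇ 0) ∧ trial-division k n (suc d))

-- Roughness is the invariant: no nontrivial divisor lies below `suc d`, and each failed division
-- raises this bound.
trial-division-sound : ∀ k n d → .{{NonTrivial n}} → suc d Rough n → T (trial-division k n d) → Prime n
trial-division-sound zero n d rough n<d² = rough∧square>⇒prime rough (<ᵇ⇒< n (suc d * suc d) n<d²)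
trial-division-sound (suc k) n d rough passed with Equivalence.to (T-∨ {n <ᵇ suc d * suc d}) passed
... | inj₁ n<d² = rough∧square>⇒prime rough (<ᵇ⇒< n (suc d * suc d) n<d²)
... | inj₂ rest with Equivalence.to (T-∧ {not (n % suc d ≡ᵇ 0)}) rest
...   | d∤n , rest′ = trial-division-sound k n (suc d) (∤⇒rough-suc ∤n rough) rest′
  where
  ∤n : ¬ suc d ∣ n
  ∤n d∣n = subst (λ r → T (not (r ≡ᵇ 0))) (n∣m⇒m%n≡0 n (suc d) d∣n) d∤n

isPrime : ℕ → ℕ → Bool
isPrime k n = (1 <ᵇ n) ∧ trial-division k n 1

isPrime-sound : ∀ k n → T (isPrime k n) → Prime n
isPrime-sound k n passed with Equivalence.to (T-∧ {1 <ᵇ n}) passed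
... | 1<n , rest = trial-division-sound k n 1 {{n>1⇒nonTrivial (<ᵇ⇒< 1 n 1<n)}} 2-rough rest

-- A prime p serves all n with p < 6 n and n ≤ (p − 1) / 5.
chain : ℕ → ℕ → List ℕ → Bool
chain k lo [] = true
chain k lo (p ∷ ps) = isPrime k p ∧ ((p <ᵇ 6 * lo) ∧ chain k (suc (pred p / 5)) ps)

chain-end : ℕ → List ℕ → ℕ
chain-end lo [] = lo
chain-end lo (p ∷ ps) = chain-end (suc (pred p / 5)) ps

chain-sound : ∀ k lo ps → T (chain k lo ps) → ∀ n → lo ≤ n → n < chain-end lo ps → PrimeBetween n
chain-sound k lo [] _ n lo≤n n<lo = contradiction lo≤n (<⇒≱ n<lo)
chain-sound k lo (p ∷ ps) valid n lo≤n n<end with Equivalence.to (T-∧ {isPrime k p}) valid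
... | p-passed , valid′ with Equivalence.to (T-∧ {p <ᵇ 6 * lo}) valid′
...   | p<6lo , valid″ with ≤-<-connex n (pred p / 5)
...     | inj₁ n≤ = p , pp , 5n<p , <-≤-trans (<ᵇ⇒< p (6 * lo) p<6lo) (*-monoʳ-≤ 6 lo≤n)
  where
  open ≤-Reasoning
  pp = isPrime-sound k p p-passed
  instance _ = prime⇒nonZero pp
  5n<p : 5 * n < p
  5n<p = begin-strict
    5 * n              ≤⟨ *-monoʳ-≤ 5 n≤ ⟩
    5 * (pred p / 5)   ≡⟨ *-comm 5 (pred p / 5) ⟩
    pred p / 5 * 5     ≤⟨ m/n*n≤m (pred p) 5 ⟩
    pred p             <⟨ n<1+n (pred p) ⟩
    suc (pred p)       ≡⟨ suc-pred p ⟩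
    p                  ∎
...     | inj₂ >n = chain-sound k (suc (pred p / 5)) ps valid″ n >n n<end

chain-primes : List ℕ
chain-primes =
  11 ∷ 17 ∷ 23 ∷ 29 ∷ 31 ∷ 41 ∷ 53 ∷ 61 ∷ 73 ∷ 89 ∷
  107 ∷ 131 ∷ 157 ∷ 191 ∷ 233 ∷ 281 ∷ 337 ∷ 401 ∷ 479 ∷ 571 ∷
  683 ∷ 821 ∷ 983 ∷ 1181 ∷ 1409 ∷ 1669 ∷ 2003 ∷ 2399 ∷ 2879 ∷ 3449 ∷
  4139 ∷ 4967 ∷ 5953 ∷ 7129 ∷ 8543 ∷ 10253 ∷ 12301 ∷ 14759 ∷ 17707 ∷ 21247 ∷
  25471 ∷ 30559 ∷ 36671 ∷ 43997 ∷ 52783 ∷ 63337 ∷ 76003 ∷ 91199 ∷ 109433 ∷ 131321 ∷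
  157579 ∷ 189067 ∷ 226871 ∷ 272249 ∷ 326693 ∷ 392033 ∷ 470429 ∷ 564497 ∷ 677387 ∷ 812857 ∷
  975427 ∷ 1170511 ∷ 1404617 ∷ 1685543 ∷ 2022649 ∷ 2427179 ∷ 2912579 ∷ 3495077 ∷ []

small : ∀ n → 1 < n → n < 693600 → PrimeBetween n
-- 2000 steps of trial division suffice because `2000 * 2000` exceeds the last prime in the list.
small n 1<n n< = chain-sound 2000 2 chain-primes _ n 1<n
  (<-≤-trans n< (≤ᵇ⇒≤ 693600 (chain-end 2 chain-primes) _))

corollary2p2p12 : (n : ℕ) → 1 < n → ∃[ p ] (Prime p × 5 * n < p × p < 6 * n)
corollary2p2p12 n 1<n with <-≤-connex n 693600
... | inj₁ n< = small n 1<n n<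
... | inj₂ n≥ = large n n≥
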